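{- Let $\mathcal{P}$ be a parametrised propositional logic program over a finite alphabet $\Sigma=\Sigma_p\cup\Sigma_d$ that is positive (no negation occurs in rule bodies). Then the parametrised immediate consequence operator $\mathcal{T}_{\mathcal{P}}:L^d_p\to L^d_p$ is monotone, and for every $\Sigma$-interpretation $J$: $J\models_{wf}\mathcal{P}$ if and only if $J\models\mathrm{Th}(\mathrm{lfp}(\mathcal{T}_{\mathcal{P}}))$.
   Context: A parametrised logic program $\mathcal{P}$ is a finite set of rules $h\leftarrow l_1\wedge\dots\wedge l_n$ where $h\in\Sigma_d$ and each $l_i$ is an atom of $\Sigma$ or its negation; $\Sigma_p$ are parameter symbols, $\Sigma_d$ defined symbols. For $q\in\Sigma_d$, $\varphi_q$ is the disjunction of the bodies of all rules with head $q$ (empty disjunction $=$ false, empty body $=$ true). $L_p$: equivalence classes $\overline\varphi$ of propositional formulas over $\Sigma_p$ ordered by entailment; $L^d_p$: maps $\Sigma_d\to L_p$ ordered pointwise (symbolic interpretations). Evaluation of a formula $\varphi$ over $\Sigma$ in $\mathcal{A}\in L^d_p$: replace each $q\in\Sigma_d$ by a representative of $\mathcal{A}(q)$ and keep atoms of $\Sigma_p$, taking the equivalence class; $\mathcal{T}_{\mathcal{P}}(\mathcal{A})(q)=\varphi_q^{\mathcal{A}}$. $\mathrm{Th}(\mathcal{A})$ is the propositional theory $\bigwedge_{q\in\Sigma_d}(q\leftrightarrow\psi_q)$ with $\psi_q$ a representative of $\mathcal{A}(q)$ (unique up to equivalence). Parametrised well-founded semantics: for $I\in 2^{\Sigma_p}$,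 $T^I_{\mathcal{P}}:2^{\Sigma_d}\to 2^{\Sigma_d}$ maps $J'$ to $\{q\mid \varphi_q\text{ true in }I\cup J'\}$, and $\Psi^I_{\mathcal{P}}$ on pairs $(J_1,J_2)$ of $\Sigma_d$-interpretations is Fitting's operator: $\Psi^I_{\mathcal{P}}(J_1,J_2)_1=\{q\mid\exists$ rule with head $q$ whose body is true under Kleene three-valued evaluation in $(J_1,J_2)$ with $\Sigma_p$ fixed to $I\}$, $\Psi^I_{\mathcal{P}}(J_1,J_2)_2=\{q\mid\exists$ rule with head $q$ whose body is not false there$\}$. A partial $\Psi$-stable fixpoint is $(x,y)$ with $x=\mathrm{lfp}(\Psi(\cdot,y)_1)$, $y=\mathrm{lfp}(\Psi(x,\cdot)_2)$, and the $\Psi$-well-founded fixpoint is the least precise such pair (precision: $(x,y)\leq_p(u,v)$ iff $x\subseteq u$, $v\subseteq y$). $J\models_{wf}\mathcal{P}$ iff $(J\cap\Sigma_d,J\cap\Sigma_d)$ is the $\Psi^{J\cap\Sigma_p}_{\mathcal{P}}$-well-founded fixpoint of $T^{J\cap\Sigma_p}_{\mathcal{P}}$. $\models$ is classical propositional satisfaction. -}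

module Defs where

open import Data.Bool using (Bool; true; false; not; _∧_; _∨_)
open import Data.Bool.Properties using (≤-poset)
open import Data.Fin using (Fin; _≟_)
open import Data.List using (List; []; _∷_; map; foldr; filter; any; tabulate)
open import Data.List.Relation.Unary.All using (All)
open import Data.Nat using (ℕ)
open import Data.Product using (_×_; _,_; proj₁; proj₂)
open import Data.Product.Relation.Binary.Pointwise.NonDependent using (×-poset)
open import Data.Sum using (_⊎_; inj₁; inj₂; [_,_])
open import Function using (_∘_)
open import Level using (0ℓ)
open import Relation.Binary.Bundles using (Poset)
open import Relation.Binary.Definitions using (Monotonic₁)
open import Relation.Binary.PropositionalEquality using (_≡_; refl; cong; cong₂)
open import Relation.Nullary using (does; yes; no)
import Relation.Binary.Construct.Flip.EqAndOrd as Flip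
import Relation.Binary.Construct.Interior.Symmetric as SymInterior

pointwise : Set → Poset 0ℓ 0ℓ 0ℓ → Poset 0ℓ 0ℓ 0ℓ
pointwise A L = record
  { Carrier        = A → L.Carrier
  ; _≈_            = λ f g → ∀ a → f a L.≈ g a
  ; _≤_            = λ f g → ∀ a → f a L.≤ g a
  ; isPartialOrder = record
    { isPreorder = record
      { isEquivalence = record
        { refl  = λ _ → L.Eq.refl
        ; sym   = λ p a → L.Eq.sym (p a)
        ; trans = λ p q a → L.Eq.trans (p a) (q a)
        }
      ; reflexive = λ p a → L.reflexive (p a)
      ; trans     = λ p q a → L.trans (p a) (q a)
      }
    ; antisym = λ p q a → L.antisym (p a) (q a)
    }
  }
  where module L = Poset L

module _ (L : Poset 0ℓ 0ℓ 0ℓ) where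
  open Poset L

  IsMonotone : (Carrier → Carrier) → Set
  IsMonotone = Monotonic₁ _≤_ _≤_

  IsLeast : (Carrier → Set) → Carrier → Set
  IsLeast S x = S x × (∀ y → S y → x ≤ y)

  IsLfp : (Carrier → Carrier) → Carrier → Set
  IsLfp f = IsLeast (λ x → f x ≈ x)

-- The precision order: (x , y) ≤ₚ (u , v) iff x ≤ u and v ≤ y.
precision : Poset 0ℓ 0ℓ 0ℓ → Poset 0ℓ 0ℓ 0ℓ
precision L = ×-poset L (Flip.poset L)

module _ (L : Poset 0ℓ 0ℓ 0ℓ) where
  open Poset L using (Carrier)

  IsPartialStable : (Carrier × Carrier → Carrier × Carrier) → Carrier × Carrier → Set
  IsPartialStable Ψ (x , y) =
    IsLfp L (λ z → proj₁ (Ψ (z , y))) x × IsLfp L (λ z → proj₂ (Ψ (x , z))) y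

  IsWellFounded : (Carrier × Carrier → Carrier × Carrier) → Carrier × Carrier → Set
  IsWellFounded Ψ = IsLeast (precision L) (IsPartialStable Ψ)

infixr 7 _∧ᶠ_
infixr 6 _∨ᶠ_
infix  5 _↔ᶠ_
infix  4 _⊨_ _⊩_

data Formula (A : Set) : Set where
  atom      : A → Formula A
  ⊤ᶠ ⊥ᶠ     : Formula A
  ¬ᶠ_       : Formula A → Formula A
  _∧ᶠ_ _∨ᶠ_ : Formula A → Formula A → Formula A

_↔ᶠ_ : ∀ {A} → Formula A → Formula A → Formula A
φ ↔ᶠ ψ = (¬ᶠ φ ∨ᶠ ψ) ∧ᶠ (¬ᶠ ψ ∨ᶠ φ)

⋀ ⋁ : ∀ {A} → List (Formula A) → Formula A
⋀ = foldr _∧ᶠ_ ⊤ᶠ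
⋁ = foldr _∨ᶠ_ ⊥ᶠ

-- An element of 2^A, as a characteristic function.
Interpretation : Set → Set
Interpretation A = A → Bool

-- Its order is inclusion, and its equality extensional equality.
2^_ : Set → Poset 0ℓ 0ℓ 0ℓ
2^ A = pointwise A ≤-poset

eval : ∀ {A} → Interpretation A → Formula A → Bool
eval I (atom a) = I a
eval I ⊤ᶠ       = true
eval I ⊥ᶠ       = false
eval I (¬ᶠ φ)   = not (eval I φ)
eval I (φ ∧ᶠ ψ) = eval I φ ∧ eval I ψ
eval I (φ ∨ᶠ ψ) = eval I φ ∨ eval I ψ

_⊨_ : ∀ {A} → Interpretation A → Formula A → Set
I ⊨ φ = eval I φ ≡ true

_⊩_ : ∀ {A} → Formula A → Formula A → Set
φ ⊩ ψ = ∀ I → I ⊨ φ → I ⊨ ψ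

substitute : ∀ {A B} → (A → Formula B) → Formula A → Formula B
substitute σ (atom a) = σ a
substitute σ ⊤ᶠ       = ⊤ᶠ
substitute σ ⊥ᶠ       = ⊥ᶠ
substitute σ (¬ᶠ φ)   = ¬ᶠ substitute σ φ
substitute σ (φ ∧ᶠ ψ) = substitute σ φ ∧ᶠ substitute σ ψ
substitute σ (φ ∨ᶠ ψ) = substitute σ φ ∨ᶠ substitute σ ψ

-- Throughout, Σₚ = Fin m and Σ_d = Fin n.
Symbol : ℕ → ℕ → Set
Symbol m n = Fin m ⊎ Fin n

data Literal (m n : ℕ) : Set where
  pos neg : Symbol m n → Literal m n

record Rule (m n : ℕ) : Set where
  constructor _⟵_
  field
    head : Fin n
    body : List (Literal m n)

open Rule public

-- A finite set of rules; nothing below depends on order or repetitions.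
Program : ℕ → ℕ → Set
Program m n = List (Rule m n)

data IsPositive {m n : ℕ} : Literal m n → Set where
  pos : ∀ a → IsPositive (pos a)

Positive : ∀ {m n} → Program m n → Set
Positive = All (λ r → All IsPositive (body r))

literalFormula : ∀ {m n} → Literal m n → Formula (Symbol m n)
literalFormula (pos a) = atom a
literalFormula (neg a) = ¬ᶠ atom a

bodyFormula : ∀ {m n} → List (Literal m n) → Formula (Symbol m n)
bodyFormula = ⋀ ∘ map literalFormula

φ[_] : ∀ {m n} → Program m n → Fin n → Formula (Symbol m n)
φ[ P ] q = ⋁ (map (bodyFormula ∘ body) (filter (λ r → head r ≟ q) P))

-- Equivalence classes of formulas are given by representatives: the equality
-- of this poset is mutual entailment.
Lₚ : ℕ → Poset 0ℓ 0ℓ 0ℓ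
Lₚ m = SymInterior.poset {A = Formula (Fin m)} {R = _⊩_}
  (λ _ p → p) (λ φ⊩ψ ψ⊩χ I p → ψ⊩χ I (φ⊩ψ I p))

Lᵈₚ : ℕ → ℕ → Poset 0ℓ 0ℓ 0ℓ
Lᵈₚ m n = pointwise (Fin n) (Lₚ m)

SymbolicInterpretation : ℕ → ℕ → Set
SymbolicInterpretation m n = Poset.Carrier (Lᵈₚ m n)

_^_ : ∀ {m n} → Formula (Symbol m n) → SymbolicInterpretation m n → Formula (Fin m)
φ ^ 𝒜 = substitute [ atom , 𝒜 ] φ

𝒯 : ∀ {m n} → Program m n → SymbolicInterpretation m n → SymbolicInterpretation m n
𝒯 P 𝒜 q = φ[ P ] q ^ 𝒜

Th : ∀ {m n} → SymbolicInterpretation m n → Formula (Symbol m n)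
Th 𝒜 = ⋀ (tabulate λ q → atom (inj₂ q) ↔ᶠ substitute (atom ∘ inj₁) (𝒜 q))

T[_,_] : ∀ {m n} → Program m n → Interpretation (Fin m) →
         Interpretation (Fin n) → Interpretation (Fin n)
T[ P , I ] J′ q = eval [ I , J′ ] (φ[ P ] q)

-- A truth value is a pair (is it true? , is it not false?), so that
-- t = (true , true), f = (false , false), u = (false , true); on these the
-- operations below are Kleene's. The fourth value (true , false) arises only
-- from pairs (J₁ , J₂) with J₁ ⊈ J₂, on which this is the usual symmetric
-- extension of the Kleene valuation to the whole bilattice.
TruthValue : Set
TruthValue = Bool × Bool

isTrue isNotFalse : TruthValue → Bool
isTrue     = proj₁
isNotFalse = proj₂

¬ᵏ_ : TruthValue → TruthValue
¬ᵏ (l , u) = not u , not l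

_∧ᵏ_ : TruthValue → TruthValue → TruthValue
(l , u) ∧ᵏ (l′ , u′) = l ∧ l′ , u ∧ u′

module _ {m n : ℕ} (I : Interpretation (Fin m))
         (J : Interpretation (Fin n) × Interpretation (Fin n)) where

  symbolValue : Symbol m n → TruthValue
  symbolValue (inj₁ p) = I p , I p
  symbolValue (inj₂ q) = proj₁ J q , proj₂ J q

  literalValue : Literal m n → TruthValue
  literalValue (pos a) = symbolValue a
  literalValue (neg a) = ¬ᵏ symbolValue a

  bodyValue : List (Literal m n) → TruthValue
  bodyValue = foldr (λ l v → literalValue l ∧ᵏ v) (true , true)

Ψ[_,_] : ∀ {m n} → Program m n → Interpretation (Fin m) →
         Interpretation (Fin n) × Interpretation (Fin n) →
         Interpretation (Fin n) × Interpretation (Fin n)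
Ψ[ P , I ] J =
  (λ q → any (λ r → does (head r ≟ q) ∧ isTrue     (bodyValue I J (body r))) P) ,
  (λ q → any (λ r → does (head r ≟ q) ∧ isNotFalse (bodyValue I J (body r))) P)

_⊨wf_ : ∀ {m n} → Interpretation (Symbol m n) → Program m n → Set
_⊨wf_ {n = n} J P =
  IsWellFounded (2^ Fin n) Ψ[ P , J ∘ inj₁ ] (J ∘ inj₂ , J ∘ inj₂)

infix 4 _⊨wf_

-- Ψ agrees with T on exact pairs, which is what makes a Ψ-well-founded
-- fixpoint one "of T".

module _ {m n : ℕ} (I : Interpretation (Fin m)) (J′ : Interpretation (Fin n)) where

  private
    value-exact : (ls : List (Literal m n)) →
                  bodyValue I (J′ , J′) ls ≡
                  (eval [ I , J′ ] (bodyFormula ls) , eval [ I , J′ ] (bodyFormula ls))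
    value-exact []                  = refl
    value-exact (pos (inj₁ p) ∷ ls) = cong (_ ∧ᵏ_) (value-exact ls)
    value-exact (pos (inj₂ q) ∷ ls) = cong (_ ∧ᵏ_) (value-exact ls)
    value-exact (neg (inj₁ p) ∷ ls) = cong (_ ∧ᵏ_) (value-exact ls)
    value-exact (neg (inj₂ q) ∷ ls) = cong (_ ∧ᵏ_) (value-exact ls)

  Ψ-exact₁ : ∀ P q → proj₁ (Ψ[ P , I ] (J′ , J′)) q ≡ T[ P , I ] J′ q
  Ψ-exact₁ []      q = refl
  Ψ-exact₁ (r ∷ P) q with head r ≟ q
  ... | yes _ = cong₂ _∨_ (cong proj₁ (value-exact (body r))) (Ψ-exact₁ P q)
  ... | no  _ = Ψ-exact₁ P q

  Ψ-exact₂ : ∀ P q → proj₂ (Ψ[ P , I ] (J′ , J′)) q ≡ T[ P , I ] J′ q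
  Ψ-exact₂ []      q = refl
  Ψ-exact₂ (r ∷ P) q with head r ≟ q
  ... | yes _ = cong₂ _∨_ (cong proj₂ (value-exact (body r))) (Ψ-exact₂ P q)
  ... | no  _ = Ψ-exact₂ P q

{-# OPTIONS --safe #-}
-- On a positive program both components of Fitting's operator reduce to T^I, so
-- partial stable fixpoints are pairs of least fixpoints of T^I and the
-- well-founded fixpoint is (lfp T^I , lfp T^I). Substitution commutes with
-- evaluation: 𝒜 ↦ eval I ∘ 𝒜 turns 𝒯 into T^I for every I. The iteration of T^I
-- from the bottom stabilises after a number of steps that depends only on n, not
-- on I; hence the iteration of 𝒯 stabilises too, and its limit evaluates under
-- each I to lfp T^I.
module Submission where

open import Defs
open import Data.Bool using (true; false; not; _∧_; _∨_; b≤b; f≤t)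
open import Data.Bool.Properties using (∧-conicalˡ; ∧-conicalʳ; ≤-minimum; ≤-maximum)
open import Data.Fin using (Fin; zero; suc)
open import Data.Fin.Properties using (all?; ¬∀⟶∃¬)
open import Data.Fin.Subset using (∣_∣)
open import Data.Fin.Subset.Properties using (∣p∣≤n; p⊂q⇒∣p∣<∣q∣)
open import Data.List using (List; []; _∷_; tabulate)
open import Data.List.Relation.Unary.All using (All; []; _∷_)
open import Data.Nat using (ℕ; zero; suc; z≤n; s≤s; _≤_; _<_)
open import Data.Nat.GeneralisedArithmetic using (fold)
open import Data.Nat.Properties using (<⇒≱; ≤-trans)
open import Data.Product using (_×_; ∃; _,_; proj₁; proj₂)
open import Data.Sum using (_⊎_; inj₁; inj₂; [_,_])
open import Data.Vec.Properties using (lookup∘tabulate; lookup⇒[]=; []=⇒lookup)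
open import Function using (_∘_)
open import Function.Bundles using (_⇔_; mk⇔; Equivalence)
open import Level using (0ℓ)
open import Relation.Binary.Bundles using (Poset)
open import Relation.Binary.PropositionalEquality using (_≡_; _≗_; refl; sym; trans; cong; cong₂)
open import Relation.Nullary using (¬_; yes; no; contradiction)
import Data.Bool as Bool
import Data.Bool.Properties as Bool
import Data.Fin as Fin
import Data.Vec as Vec
import Relation.Binary.Construct.Interior.Symmetric as SymInterior
import Relation.Binary.Properties.Poset as PosetProperties

-- Least fixpoints and iteration from the bottom in a poset.

module _ (L : Poset 0ℓ 0ℓ 0ℓ) where
  open Poset L renaming (_≤_ to _⊑_; trans to ⊑-trans)
  open PosetProperties L using (mono⇒cong)

  IsLfp-unique : ∀ {f x y} → IsLfp L f x → IsLfp L f y → x ≈ y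
  IsLfp-unique (fx≈x , x-least) (fy≈y , y-least) =
    antisym (x-least _ fy≈y) (y-least _ fx≈x)

  IsLfp-respˡ : ∀ {f g x} → (∀ z → f z ≈ g z) → IsLfp L f x → IsLfp L g x
  IsLfp-respˡ {x = x} f≈g (fx≈x , x-least) =
    Eq.trans (Eq.sym (f≈g x)) fx≈x ,
    λ y gy≈y → x-least y (Eq.trans (f≈g y) gy≈y)

  module _ {f : Carrier → Carrier} (f-mono : IsMonotone L f) where

    -- Monotonicity is what makes `f` respect the equality `≈` of the poset.
    IsLfp-respʳ : ∀ {x y} → x ≈ y → IsLfp L f x → IsLfp L f y
    IsLfp-respʳ x≈y (fx≈x , x-least) =
      Eq.trans (mono⇒cong f-mono (Eq.sym x≈y)) (Eq.trans fx≈x x≈y) ,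
      λ z fz≈z → ⊑-trans (reflexive (Eq.sym x≈y)) (x-least z fz≈z)

    module _ {⊥ : Carrier} (⊥-min : ∀ x → ⊥ ⊑ x) where

      fold-increasing : ∀ k → fold ⊥ f k ⊑ f (fold ⊥ f k)
      fold-increasing zero    = ⊥-min _
      fold-increasing (suc k) = f-mono (fold-increasing k)

      fold-≤-fixpoint : ∀ {x} → f x ≈ x → ∀ k → fold ⊥ f k ⊑ x
      fold-≤-fixpoint fx≈x zero    = ⊥-min _
      fold-≤-fixpoint fx≈x (suc k) =
        ⊑-trans (f-mono (fold-≤-fixpoint fx≈x k)) (reflexive fx≈x)

-- The order on truth values.

≤⇒implication : ∀ {b c} → b Bool.≤ c → b ≡ true → c ≡ true
≤⇒implication b≤b b≡true = b≡true

implication⇒≤ : ∀ {b c} → (b ≡ true → c ≡ true) → b Bool.≤ c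
implication⇒≤ {false}     _ = ≤-minimum _
implication⇒≤ {true}  {c} h rewrite h refl = b≤b

≤∧≢⇒< : ∀ {b c} → b Bool.≤ c → ¬ b ≡ c → b ≡ false × c ≡ true
≤∧≢⇒< f≤t _   = refl , refl
≤∧≢⇒< b≤b b≢b = contradiction refl b≢b

-- Stabilisation of monotone iteration on a finite powerset.

module _ {n : ℕ} where
  open Poset (2^ Fin n) using (_≈_) renaming (_≤_ to _⊑_)
  open PosetProperties (2^ Fin n) using (mono⇒cong)

  -- Passing to `Subset` gives access to the strict growth of cardinality along proper inclusions.
  size : Interpretation (Fin n) → ℕ
  size J = ∣ Vec.tabulate J ∣

  size-strict : ∀ {J K} → J ⊑ K → ¬ J ≈ K → size J < size K
  -- Finiteness and decidable equality turn `J≉K` into an explicit index of difference.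
  size-strict {J} {K} J⊑K J≉K with ¬∀⟶∃¬ n _ (λ i → J i Bool.≟ K i) J≉K
  ... | i , Ji≢Ki = p⊂q⇒∣p∣<∣q∣
    ( (λ {j} j∈J → member K j (≤⇒implication (J⊑K j) (value J j∈J)))
    , i
    , member K i (proj₂ Ji<Ki)
    , λ i∈J → contradiction (trans (sym (value J i∈J)) (proj₁ Ji<Ki)) λ () )
    where
    Ji<Ki = ≤∧≢⇒< (J⊑K i) Ji≢Ki

    member : ∀ L j → L j ≡ true → Vec.tabulate L Vec.[ j ]= true
    member L j Lj = lookup⇒[]= j _ (trans (lookup∘tabulate L j) Lj)

    value : ∀ L {j} → Vec.tabulate L Vec.[ j ]= true → L j ≡ true
    value L {j} j∈L = trans (sym (lookup∘tabulate L j)) ([]=⇒lookup j∈L)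

  module _ {f : Interpretation (Fin n) → Interpretation (Fin n)}
           (f-mono : IsMonotone (2^ Fin n) f) where

    private
      x : ℕ → Interpretation (Fin n)
      x = fold (λ _ → false) f

    -- A step from an iterate that is not fixed adds at least one element, and a fixed iterate stays
    -- fixed.
    fixed-or-large : ∀ k → f (x k) ≈ x k ⊎ k ≤ size (x k)
    fixed-or-large zero    = inj₂ z≤n
    fixed-or-large (suc k) with all? (λ i → x k i Bool.≟ f (x k) i) | fixed-or-large k
    ... | yes xₖ≈fxₖ | _           = inj₁ (mono⇒cong f-mono (sym ∘ xₖ≈fxₖ))
    ... | no  xₖ≉fxₖ | inj₁ fxₖ≈xₖ = contradiction (sym ∘ fxₖ≈xₖ) xₖ≉fxₖ
    ... | no  xₖ≉fxₖ | inj₂ k≤∣xₖ∣ = inj₂ (≤-trans (s≤s k≤∣xₖ∣)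
      (size-strict (fold-increasing (2^ Fin n) f-mono (λ _ _ → ≤-minimum _) k) xₖ≉fxₖ))

    -- No subset of an `n`-element set has size `suc n`. After only `n` steps the dichotomy would
    -- leave size `n` open, hence the extra step.
    fold-stabilises : f (x (suc n)) ≈ x (suc n)
    fold-stabilises with fixed-or-large (suc n)
    ... | inj₁ fixed = fixed
    ... | inj₂ large = contradiction (∣p∣≤n (Vec.tabulate (x (suc n)))) (<⇒≱ large)

-- Evaluation, substitution and the models of `Th`.

eval-cong : ∀ {A} {I J : Interpretation A} → I ≗ J → eval I ≗ eval J
eval-cong I≗J (atom a) = I≗J a
eval-cong I≗J ⊤ᶠ       = refl
eval-cong I≗J ⊥ᶠ       = refl
eval-cong I≗J (¬ᶠ φ)   = cong not (eval-cong I≗J φ)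
eval-cong I≗J (φ ∧ᶠ ψ) = cong₂ _∧_ (eval-cong I≗J φ) (eval-cong I≗J ψ)
eval-cong I≗J (φ ∨ᶠ ψ) = cong₂ _∨_ (eval-cong I≗J φ) (eval-cong I≗J ψ)

eval-substitute : ∀ {A B} (I : Interpretation B) (σ : A → Formula B) φ →
                  eval I (substitute σ φ) ≡ eval (eval I ∘ σ) φ
eval-substitute I σ (atom a) = refl
eval-substitute I σ ⊤ᶠ       = refl
eval-substitute I σ ⊥ᶠ       = refl
eval-substitute I σ (¬ᶠ φ)   = cong not (eval-substitute I σ φ)
eval-substitute I σ (φ ∧ᶠ ψ) = cong₂ _∧_ (eval-substitute I σ φ) (eval-substitute I σ ψ)
eval-substitute I σ (φ ∨ᶠ ψ) = cong₂ _∨_ (eval-substitute I σ φ) (eval-substitute I σ ψ)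

⊨-⋀-tabulate : ∀ {A n} {I : Interpretation A} (f : Fin n → Formula A) →
               (I ⊨ ⋀ (tabulate f)) ⇔ (∀ i → I ⊨ f i)
⊨-⋀-tabulate {I = I} f = mk⇔ (to f) (from f)
  where
  to : ∀ {n} (f : Fin n → _) → I ⊨ ⋀ (tabulate f) → ∀ i → I ⊨ f i
  to f p zero    = ∧-conicalˡ _ _ p
  to f p (suc i) = to (f ∘ suc) (∧-conicalʳ _ _ p) i

  from : ∀ {n} (f : Fin n → _) → (∀ i → I ⊨ f i) → I ⊨ ⋀ (tabulate f)
  from {zero}  f p = refl
  from {suc n} f p = cong₂ _∧_ (p zero) (from (f ∘ suc) (p ∘ suc))

⊨-↔ᶠ : ∀ {A} {I : Interpretation A} φ ψ → (I ⊨ φ ↔ᶠ ψ) ⇔ (eval I φ ≡ eval I ψ)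
⊨-↔ᶠ {I = I} φ ψ with eval I φ | eval I ψ
... | true  | true  = mk⇔ (λ _ → refl) (λ _ → refl)
... | true  | false = mk⇔ (λ ()) (λ ())
... | false | true  = mk⇔ (λ ()) (λ ())
... | false | false = mk⇔ (λ _ → refl) (λ _ → refl)

module _ {m n : ℕ} where

  eval-𝒯 : ∀ (P : Program m n) I 𝒜 q → eval I (𝒯 P 𝒜 q) ≡ T[ P , I ] (eval I ∘ 𝒜) q
  eval-𝒯 P I 𝒜 q = trans (eval-substitute I _ (φ[ P ] q))
    -- The valuations `eval I ∘ [ atom , 𝒜 ]` and `[ I , eval I ∘ 𝒜 ]` reduce to the same value only
    -- once the kind of symbol is known.
    (eval-cong (λ { (inj₁ _) → refl ; (inj₂ _) → refl }) (φ[ P ] q))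

  -- The representatives mention parameters only, so `Th 𝒜` prescribes the defined part of a model
  -- as a function of its parameter part.
  ⊨-Th : ∀ {J} (𝒜 : SymbolicInterpretation m n) →
         (J ⊨ Th 𝒜) ⇔ (J ∘ inj₂ ≗ eval (J ∘ inj₁) ∘ 𝒜)
  ⊨-Th {J} 𝒜 = mk⇔
    (λ J⊨Th q → trans (equiv q .Equivalence.to (conj .Equivalence.to J⊨Th q)) (lift q))
    (λ J≗𝒜 → conj .Equivalence.from λ q →
      equiv q .Equivalence.from (trans (J≗𝒜 q) (sym (lift q))))
    where
    ψ : Fin n → Formula (Symbol m n)
    ψ q = substitute (atom ∘ inj₁) (𝒜 q)

    conj = ⊨-⋀-tabulate {I = J} λ q → atom (inj₂ q) ↔ᶠ ψ q

    equiv : ∀ q → (J ⊨ atom (inj₂ q) ↔ᶠ ψ q) ⇔ (J (inj₂ q) ≡ eval J (ψ q))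
    equiv q = ⊨-↔ᶠ {I = J} (atom (inj₂ q)) (ψ q)

    lift : ∀ q → eval J (ψ q) ≡ eval (J ∘ inj₁) (𝒜 q)
    lift q = eval-substitute J (atom ∘ inj₁) (𝒜 q)

-- Positive programs: monotonicity and the form of Fitting's operator.

∧-mono-≤ : ∀ {a b c d} → a Bool.≤ b → c Bool.≤ d → a ∧ c Bool.≤ b ∧ d
∧-mono-≤         f≤t _   = ≤-minimum _
∧-mono-≤ {false} b≤b _   = b≤b
∧-mono-≤ {true}  b≤b c≤d = c≤d

∨-mono-≤ : ∀ {a b c d} → a Bool.≤ b → c Bool.≤ d → a ∨ c Bool.≤ b ∨ d
∨-mono-≤         f≤t _   = ≤-maximum _
∨-mono-≤ {false} b≤b c≤d = c≤d
∨-mono-≤ {true}  b≤b _   = b≤b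

module _ {m n : ℕ} where

  private
    S = 2^ Fin n

  bodyFormula-mono : {ls : List (Literal m n)} → All IsPositive ls → ∀ {J K} →
                     (∀ a → J a Bool.≤ K a) →
                     eval J (bodyFormula ls) Bool.≤ eval K (bodyFormula ls)
  bodyFormula-mono []            J≤K = b≤b
  bodyFormula-mono (pos a ∷ ls⁺) J≤K = ∧-mono-≤ (J≤K a) (bodyFormula-mono ls⁺ J≤K)

  φ-mono : {P : Program m n} → Positive P → ∀ {J K} → (∀ a → J a Bool.≤ K a) →
           ∀ q → eval J (φ[ P ] q) Bool.≤ eval K (φ[ P ] q)
  φ-mono []                  J≤K q = b≤b
  φ-mono (_∷_ {x = r} r⁺ P⁺) J≤K q with head r Fin.≟ q
  ... | yes _ = ∨-mono-≤ (bodyFormula-mono r⁺ J≤K) (φ-mono P⁺ J≤K q)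
  ... | no  _ = φ-mono P⁺ J≤K q

  T-mono : {P : Program m n} → Positive P → ∀ I → IsMonotone S T[ P , I ]
  T-mono P⁺ I J≤K = φ-mono P⁺ λ { (inj₁ _) → b≤b ; (inj₂ q) → J≤K q }

  -- Only negation swaps the two components of a truth value; without it the first is computed from
  -- `x` and the second from `y`, over the same `I`.
  bodyValue-positive : ∀ I x y {ls : List (Literal m n)} → All IsPositive ls →
    bodyValue I (x , y) ls ≡
    (eval [ I , x ] (bodyFormula ls) , eval [ I , y ] (bodyFormula ls))
  bodyValue-positive I x y []                   = refl
  bodyValue-positive I x y (pos (inj₁ _) ∷ ls⁺) = cong (_ ∧ᵏ_) (bodyValue-positive I x y ls⁺)
  bodyValue-positive I x y (pos (inj₂ _) ∷ ls⁺) = cong (_ ∧ᵏ_) (bodyValue-positive I x y ls⁺)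

  Ψ-positive₁ : {P : Program m n} → Positive P → ∀ I x y →
                proj₁ (Ψ[ P , I ] (x , y)) ≗ T[ P , I ] x
  Ψ-positive₁ []                  I x y q = refl
  Ψ-positive₁ (_∷_ {x = r} r⁺ P⁺) I x y q with head r Fin.≟ q
  ... | yes _ = cong₂ _∨_ (cong proj₁ (bodyValue-positive I x y r⁺)) (Ψ-positive₁ P⁺ I x y q)
  ... | no  _ = Ψ-positive₁ P⁺ I x y q

  Ψ-positive₂ : {P : Program m n} → Positive P → ∀ I x y →
                proj₂ (Ψ[ P , I ] (x , y)) ≗ T[ P , I ] y
  Ψ-positive₂ []                  I x y q = refl
  Ψ-positive₂ (_∷_ {x = r} r⁺ P⁺) I x y q with head r Fin.≟ q
  ... | yes _ = cong₂ _∨_ (cong proj₂ (bodyValue-positive I x y r⁺)) (Ψ-positive₂ P⁺ I x y q)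
  ... | no  _ = Ψ-positive₂ P⁺ I x y q

  -- Each component of `Ψ` depends only on its own argument, so the two least-fixpoint conditions
  -- decouple.
  stable-positive : {P : Program m n} → Positive P → ∀ I {x y} →
    IsPartialStable S Ψ[ P , I ] (x , y) ⇔ (IsLfp S T[ P , I ] x × IsLfp S T[ P , I ] y)
  stable-positive P⁺ I {x} {y} = mk⇔
    (λ (p , q) → IsLfp-respˡ S (λ z → Ψ-positive₁ P⁺ I z y) p ,
                 IsLfp-respˡ S (λ z → Ψ-positive₂ P⁺ I x z) q)
    (λ (p , q) → IsLfp-respˡ S (λ z → sym ∘ Ψ-positive₁ P⁺ I z y) p ,
                 IsLfp-respˡ S (λ z → sym ∘ Ψ-positive₂ P⁺ I x z) q)

  wellFounded-positive : {P : Program m n} → Positive P → ∀ I {x} →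
    IsWellFounded S Ψ[ P , I ] (x , x) ⇔ IsLfp S T[ P , I ] x
  wellFounded-positive P⁺ I {x} = mk⇔
    (λ (stable , _) → proj₁ (stable-positive P⁺ I .Equivalence.to stable))
    (λ x-lfp@(Tx≈x , x-least) →
      stable-positive P⁺ I .Equivalence.from (x-lfp , x-lfp) ,
      -- Precision reverses the second component: `x` lies below `u` by leastness of `x`, and `v`
      -- below `x` by leastness of `v`.
      λ (u , v) uv-stable →
        let (u-fixed , _) , (_ , v-least) = stable-positive P⁺ I .Equivalence.to uv-stable
        in x-least u u-fixed , v-least x Tx≈x)

  -- The symbolic operator and its least fixpoint.

  𝒯-mono : {P : Program m n} → Positive P → IsMonotone (Lᵈₚ m n) (𝒯 P)
  𝒯-mono {P} P⁺ {𝒜} {ℬ} 𝒜⊩ℬ q I p = trans (eval-𝒯 P I ℬ q)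
    (≤⇒implication (T-mono P⁺ I (λ q′ → implication⇒≤ (𝒜⊩ℬ q′ I)) q)
      (trans (sym (eval-𝒯 P I 𝒜 q)) p))

  ≗⇒≈ : {𝒜 ℬ : SymbolicInterpretation m n} → (∀ I → eval I ∘ 𝒜 ≗ eval I ∘ ℬ) →
        Poset._≈_ (Lᵈₚ m n) 𝒜 ℬ
  ≗⇒≈ 𝒜≗ℬ q = (λ I p → trans (sym (𝒜≗ℬ I q)) p) SymInterior., (λ I p → trans (𝒜≗ℬ I q) p)

  ⊩⇒≤ : {𝒜 ℬ : SymbolicInterpretation m n} → Poset._≤_ (Lᵈₚ m n) 𝒜 ℬ →
        ∀ I q → eval I (𝒜 q) Bool.≤ eval I (ℬ q)
  ⊩⇒≤ 𝒜⊩ℬ I q = implication⇒≤ (𝒜⊩ℬ q I)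

  ≈⇒≗ : {𝒜 ℬ : SymbolicInterpretation m n} → Poset._≈_ (Lᵈₚ m n) 𝒜 ℬ →
        ∀ I → eval I ∘ 𝒜 ≗ eval I ∘ ℬ
  ≈⇒≗ {𝒜} {ℬ} 𝒜≈ℬ I q = Bool.≤-antisym
    (⊩⇒≤ {𝒜} {ℬ} (λ q′ → SymInterior.lhs≤rhs (𝒜≈ℬ q′)) I q)
    (⊩⇒≤ {ℬ} {𝒜} (λ q′ → SymInterior.rhs≤lhs (𝒜≈ℬ q′)) I q)

  -- The bound in `fold-stabilises` is uniform in `I`, so `suc n` steps serve all parameter
  -- valuations at once.
  lfp𝒯 : Program m n → SymbolicInterpretation m n
  lfp𝒯 P = fold (λ _ → ⊥ᶠ) (𝒯 P) (suc n)

  module _ {P : Program m n} (P⁺ : Positive P) where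

    eval-fold-𝒯 : ∀ I k → eval I ∘ fold (λ _ → ⊥ᶠ) (𝒯 P) k ≗ fold (λ _ → false) T[ P , I ] k
    eval-fold-𝒯 I zero    q = refl
    eval-fold-𝒯 I (suc k) q = trans (eval-𝒯 P I _ q)
      (PosetProperties.mono⇒cong S (T-mono P⁺ I) (eval-fold-𝒯 I k) q)

    lfp𝒯-isLfp : IsLfp (Lᵈₚ m n) (𝒯 P) (lfp𝒯 P)
    lfp𝒯-isLfp =
      -- `𝒯 P (lfp𝒯 P)` is by definition the iterate after `suc (suc n)` steps; equivalence is
      -- checked under each `I`, where iteration has stabilised.
      ≗⇒≈ {𝒯 P (lfp𝒯 P)} {lfp𝒯 P} (λ I q → trans (eval-fold-𝒯 I (suc (suc n)) q)
        (trans (fold-stabilises (T-mono P⁺ I) q) (sym (eval-fold-𝒯 I (suc n) q)))) ,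
      λ ℬ ℬ-fixed → fold-≤-fixpoint (Lᵈₚ m n) {𝒯 P}
        (λ {𝒜} {ℬ} → 𝒯-mono P⁺ {𝒜} {ℬ}) {λ _ → ⊥ᶠ} (λ _ _ _ ()) {ℬ} ℬ-fixed (suc n)

    -- Least fixpoints of `𝒯 P` are unique up to equivalence, so `𝒜` evaluates under `I` as `lfp𝒯 P`
    -- does, namely to the stabilised iterate of `T[ P , I ]`.
    lfp𝒯⇒lfpT : ∀ {𝒜} → IsLfp (Lᵈₚ m n) (𝒯 P) 𝒜 → ∀ I → IsLfp S T[ P , I ] (eval I ∘ 𝒜)
    lfp𝒯⇒lfpT {𝒜} 𝒜-lfp I = IsLfp-respʳ S (T-mono P⁺ I)
      (λ q → trans (sym (eval-fold-𝒯 I (suc n) q))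
        (≈⇒≗ {lfp𝒯 P} {𝒜} (IsLfp-unique (Lᵈₚ m n) {𝒯 P} {lfp𝒯 P} {𝒜} lfp𝒯-isLfp 𝒜-lfp) I q))
      (fold-stabilises (T-mono P⁺ I) ,
       λ y y-fixed → fold-≤-fixpoint S (T-mono P⁺ I) (λ _ _ → ≤-minimum _) y-fixed (suc n))

theorem4p8 : (m n : ℕ) (P : Program m n) → Positive P →
    IsMonotone (Lᵈₚ m n) (𝒯 P)
    × ∃ (IsLfp (Lᵈₚ m n) (𝒯 P))
    × ((𝒜 : SymbolicInterpretation m n) → IsLfp (Lᵈₚ m n) (𝒯 P) 𝒜 →
    (J : Interpretation (Symbol m n)) → (J ⊨wf P) ⇔ (J ⊨ Th 𝒜))
theorem4p8 m n P P⁺ =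
  (λ {𝒜} {ℬ} → 𝒯-mono P⁺ {𝒜} {ℬ}) ,
  (lfp𝒯 P , lfp𝒯-isLfp P⁺) ,
  λ 𝒜 𝒜-lfp J →
    let I         = J ∘ inj₁
        eval𝒜-lfp = lfp𝒯⇒lfpT P⁺ 𝒜-lfp I
    in mk⇔
      -- The defined part of `J` and the evaluation of `𝒜` are both least fixpoints of `T[ P , I ]`,
      -- hence equal.
      (λ J-wf → ⊨-Th 𝒜 .Equivalence.from
        (IsLfp-unique (2^ Fin n) (wellFounded-positive P⁺ I .Equivalence.to J-wf) eval𝒜-lfp))
      -- A model of `Th 𝒜` has the evaluation of `𝒜` as its defined part, so it inherits being the
      -- least fixpoint.
      (λ J⊨Th → wellFounded-positive P⁺ I .Equivalence.from
        (IsLfp-respʳ (2^ Fin n) (T-mono P⁺ I) (sym ∘ ⊨-Th 𝒜 .Equivalence.to J⊨Th) eval𝒜-lfp))
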